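{- Let $n$ be an even integer, let $1\le k\le n/2-1$ be an integer, and let $f:\mathbb N\to\mathbb N$ satisfy $f(n)=\omega(\sqrt n)$. Let $G$ be a $(2k+1)$-regular graph on the vertex set $[n]$. Then with high probability $\tau_{\text{lab}}(G,n)\ge (k+1)n-f(n)$.
   Context: Semi-random no-replacement multigraph process on $[n]=\{1,\dots,n\}$: let $\pi_1,\pi_2,\dots$ be independent uniformly random permutations in $S_n$. Builder's multigraph starts empty on $[n]$. In round $k\ge1$ Builder is offered the vertex $v_k:=\pi_{\lceil k/n\rceil}(k-\lfloor (k-1)/n\rfloor n)$; Builder then chooses a vertex $u_k$ according to his strategy (a rule depending on the history so far) and adds the edge $u_kv_k$ (multiple edges allowed). For a labeled graph $G$ on $[n]$ and a strategy $\mathcal S$, $\tau(\mathcal S)$ is the least $m$ such that Builder's multigraph after $m$ rounds contains $G$ as a subgraph (with the same labels). $\tau_{\text{lab}}(G,n)$ is a random variable with $\Pr(\tau_{\text{lab}}(G,n)\le k)=\max_{\mathcal S}\Pr(\tau(\mathcal S)\le k)$ for all $k\ge0$. W.h.p. means with probability tending to $1$ as $n\to\infty$. -}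

module Defs where

open import Data.Nat using (ℕ; zero; suc; _+_; _*_; _≤_; _<_)
open import Data.Bool using (T?; Bool; true; false; _∧_; _∨_; if_then_else_)
open import Data.Fin using (Fin; _≟_)
open import Data.List using (List; []; _∷_; _++_; [_]; map; concatMap; length; filter; take; allFin; cartesianProductWith)
open import Data.Bool.ListAction using (and; or)
open import Data.Vec using (Vec; lookup; toList) renaming ([] to []ᵛ; _∷_ to _∷ᵛ_)
open import Data.Product using (_×_; _,_)
open import Relation.Binary.PropositionalEquality using (_≡_)
open import Relation.Nullary.Decidable using (⌊_⌋)

record Graph (n : ℕ) : Set where
  field
    adj    : Fin n → Fin n → Bool
    sym    : ∀ i j → adj i j ≡ adj j i
    irrefl : ∀ i → adj i i ≡ false
open Graph public

deg : ∀ {n} → Graph n → Fin n → ℕ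
deg {n} G i = length (filter (λ j → adj G i j ≡? true) (allFin n))
  where
  _≡?_ : (a b : Bool) → Relation.Nullary.Decidable.Dec (a ≡ b)
  _≡?_ = Data.Bool._≟_

Regular : ∀ {n} → Graph n → ℕ → Set
Regular {n} G d = ∀ i → deg G i ≡ d

-- Deterministic Builder strategy: given the list of vertices offered so far
-- (v_1, …, v_t, including the current one v_t), choose u_t.
-- (Builder's own earlier choices are determined by the strategy, so this is
-- the full history.)
Strategy : ℕ → Set
Strategy n = List (Fin n) → Fin n

edgesFrom : ∀ {n} → Strategy n → List (Fin n) → List (Fin n) → List (Fin n × Fin n)
edgesFrom S hist []       = []
edgesFrom S hist (v ∷ vs) = (S (hist ++ [ v ]) , v) ∷ edgesFrom S (hist ++ [ v ]) vs

edges : ∀ {n} → Strategy n → List (Fin n) → List (Fin n × Fin n)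
edges S vs = edgesFrom S [] vs

eqF : ∀ {n} → Fin n → Fin n → Bool
eqF a b = ⌊ a ≟ b ⌋

hasEdge : ∀ {n} → List (Fin n × Fin n) → Fin n → Fin n → Bool
hasEdge es a b = or (map (λ { (x , y) → (eqF x a ∧ eqF y b) ∨ (eqF x b ∧ eqF y a) }) es)

containsG : ∀ {n} → Graph n → List (Fin n × Fin n) → Bool
containsG {n} G es =
  and (map (λ a → and (map (λ b → if adj G a b then hasEdge es a b else true) (allFin n))) (allFin n))

allVecs : ∀ {n} (l : ℕ) → List (Vec (Fin n) l)
allVecs zero    = []ᵛ ∷ []
allVecs {n} (suc l) = cartesianProductWith _∷ᵛ_ (allFin n) (allVecs l)

isPerm : ∀ {n} → Vec (Fin n) n → Bool
isPerm {n} v = and (map (λ i → and (map (λ j → if eqF (lookup v i) (lookup v j) then eqF i j else true) (allFin n))) (allFin n))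

perms : (n : ℕ) → List (Vec (Fin n) n)
perms n = filter (λ v → T? (isPerm v)) (allVecs n)

permSeqs : (n r : ℕ) → List (List (Vec (Fin n) n))
permSeqs n zero    = [] ∷ []
permSeqs n (suc r) = cartesianProductWith _∷_ (perms n) (permSeqs n r)

offered : ∀ {n} → ℕ → List (Vec (Fin n) n) → List (Fin n)
offered m ps = take m (concatMap toList ps)

tauLe : ∀ {n} → Graph n → Strategy n → ℕ → List (Vec (Fin n) n) → Bool
tauLe G S m ps = containsG G (edges S (offered m ps))

-- Pr(τ(S) ≤ m) = goodCount / totalCount, computed on the sample space of
-- m independent uniform permutations (which is more than enough to
-- determine the first m rounds, as n ≥ 1 in all uses).
goodCount : ∀ {n} → Graph n → Strategy n → ℕ → ℕ
goodCount {n} G S m = length (filter (λ ps → T? (tauLe G S m ps)) (permSeqs n m))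

totalCount : ℕ → ℕ → ℕ
totalCount n m = length (permSeqs n m)

{-# OPTIONS --safe #-}

-- The first k blocks give kn of the kn + n/2 edges of G, so at least n/2 edges
-- are open when the last block starts, and each of them has to be built when one
-- of its ends is offered in that block.  A vertex is offered at most once there, so
-- two vertices that are adjacent by an open edge, or have a common open neighbour,
-- cannot both be among the n - m' > f(n) vertices that the block offers only after
-- round m = kn + m'.  If one order of the block lets Builder finish, the open edges
-- have distinct offered ends, and then any maximal disjoint family F of such
-- conflicting pairs has at least n/8 members.  By a switching argument, an order of
-- the block has none of these pairs after round m with probability at most
-- n²/(|F| h²), where 2h ~ n - m', and this tends to 0 because h² = ω(n).

module Submission where

open import Defs hiding (sym)
open import Data.Nat using (ℕ; zero; suc; _+_; _*_; _∸_; _≤_; _<_; z≤n; s≤s; s≤s⁻¹; ⌊_/2⌋; NonZero; >-nonZero⁻¹)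
open import Data.Nat.Divisibility using (_∣_)
open import Data.Nat.Properties hiding (_≟_)
open import Data.Nat.Tactic.RingSolver using (solve-∀)
open import Data.Bool using (Bool; T; T?; true; false; _∧_; _∨_; if_then_else_)
open import Data.Bool.Properties using (T-∧; T-∨; T-≡)
open import Data.Fin using (Fin; toℕ; _≟_; inject≤; _↑ˡ_; _↑ʳ_)
import Data.Fin.Properties as Fin
open import Data.Fin.Permutation.Components using (transpose)
open import Data.List as List using (List; []; _∷_; _++_; [_]; map; length; filter; take; concatMap; allFin; cartesianProductWith; cartesianProduct)
open import Data.List.Properties
open import Data.List.Membership.Propositional using (_∈_; _∉_)
open import Data.List.Membership.Propositional.Properties
import Data.List.Membership.DecPropositional as DecMembership
open import Data.List.Relation.Unary.Any using (here; there)
open import Data.List.Relation.Unary.All as All using ([]; _∷_)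
import Data.List.Relation.Unary.All.Properties as All
open import Data.List.Relation.Unary.AllPairs using (AllPairs; []; _∷_)
import Data.List.Relation.Unary.AllPairs.Properties as AllPairs
open import Data.List.Relation.Unary.Unique.Propositional using (Unique)
import Data.List.Relation.Unary.Unique.Propositional.Properties as Unique
open import Data.Vec as Vec using (Vec; lookup; toList)
import Data.Vec.Properties as Vec
open import Data.Product using (∃-syntax; _×_; _,_; proj₁; proj₂; swap)
open import Data.Sum as Sum using (_⊎_; inj₁; inj₂; [_,_]′)
open import Data.Sum.Properties using (inj₁-injective; inj₂-injective)
open import Data.Unit using (tt)
open import Function using (_∘_; id; Equivalence)
open import Relation.Nullary using (¬_; Dec; yes; no; contradiction; ¬?; _×-dec_; _⊎-dec_)
open import Relation.Nullary.Decidable using (toWitness; fromWitness)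
open import Relation.Unary using (Decidable)
open import Relation.Binary.PropositionalEquality using (_≡_; _≢_; refl; sym; trans; cong; cong₂; subst; module ≡-Reasoning)

open Equivalence using (to; from)

private
  variable
    A B C : Set
    n : ℕ

-- Counting in lists and cartesian products

-- Each step deletes one occurrence of `f x` from `ys`; by injectivity the images of the remaining
-- elements survive. Injectivity is asked only on `xs`, because `switch` below is shown injective
-- only on valid data.
length-injective : ∀ (f : A → B) {xs ys} → Unique xs → (∀ {x} → x ∈ xs → f x ∈ ys) →
                   (∀ {x y} → x ∈ xs → y ∈ xs → f x ≡ f y → x ≡ y) → length xs ≤ length ys
length-injective f [] _ _ = z≤n
length-injective f {x ∷ xs} (x∉xs ∷ xs!) into inj with ∈-∃++ (into (here refl))
... | as , bs , refl = begin
  suc (length xs)           ≤⟨ s≤s (length-injective f xs! into′ (λ p q → inj (there p) (there q))) ⟩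
  suc (length (as ++ bs))   ≡⟨ length-++-sucʳ as (f x) bs ⟨
  length (as ++ f x ∷ bs)   ∎
  where
  open ≤-Reasoning
  into′ : ∀ {y} → y ∈ xs → f y ∈ as ++ bs
  into′ y∈xs with ∈-++⁻ as (into (there y∈xs))
  ... | inj₁ p = ∈-++⁺ˡ p
  ... | inj₂ (there p) = ∈-++⁺ʳ as p
  ... | inj₂ (here fy≡fx) =
    contradiction (inj (here refl) (there y∈xs) (sym fy≡fx)) (All.lookup x∉xs y∈xs)

length-cartesianProductWith : ∀ (f : A → B → C) xs ys →
  length (cartesianProductWith f xs ys) ≡ length xs * length ys
length-cartesianProductWith f [] ys = refl
length-cartesianProductWith f (x ∷ xs) ys = begin
  length (map (f x) ys ++ cartesianProductWith f xs ys)
    ≡⟨ length-++ (map (f x) ys) ⟩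
  length (map (f x) ys) + length (cartesianProductWith f xs ys)
    ≡⟨ cong₂ _+_ (length-map (f x) ys) (length-cartesianProductWith f xs ys) ⟩
  length ys + length xs * length ys ∎
  where open ≡-Reasoning

count : (A → Bool) → List A → ℕ
count Q xs = length (filter (λ x → T? (Q x)) xs)

count-++ : ∀ (Q : A → Bool) xs ys → count Q (xs ++ ys) ≡ count Q xs + count Q ys
count-++ Q xs ys = trans (cong length (filter-++ (λ x → T? (Q x)) xs ys)) (length-++ (filter (λ x → T? (Q x)) xs))

count-map : ∀ (Q : B → Bool) (f : A → B) xs → count Q (map f xs) ≡ count (Q ∘ f) xs
count-map Q f [] = refl
count-map Q f (x ∷ xs) with Q (f x)
... | true  = cong suc (count-map Q f xs)
... | false = count-map Q f xs

count-cartesianProductWith-∷ : ∀ (Q : C → Bool) (f : A → B → C) x xs ys →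
  count Q (cartesianProductWith f (x ∷ xs) ys) ≡
  count (Q ∘ f x) ys + count Q (cartesianProductWith f xs ys)
count-cartesianProductWith-∷ Q f x xs ys =
  trans (count-++ Q (map (f x) ys) _) (cong (_+ _) (count-map Q (f x) ys))

length-cartesianProductWith-∷ : ∀ (f : A → B → C) x xs ys →
  length (cartesianProductWith f (x ∷ xs) ys) ≡ length ys + length (cartesianProductWith f xs ys)
length-cartesianProductWith-∷ f x xs ys =
  trans (length-++ (map (f x) ys)) (cong (_+ _) (length-map (f x) ys))

count-cong : ∀ {Q R : A → Bool} → (∀ x → Q x ≡ R x) → ∀ xs → count Q xs ≡ count R xs
count-cong Q≗R [] = refl
count-cong {Q = Q} {R} Q≗R (x ∷ xs) with Q x | R x | Q≗R x
... | true  | _ | refl = cong suc (count-cong Q≗R xs)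
... | false | _ | refl = count-cong Q≗R xs

count-const : ∀ (Q : A → Bool) {b} → (∀ x → Q x ≡ b) → ∀ xs → count Q xs ≡ (if b then length xs else 0)
count-const Q {true}  eq xs = cong length (filter-all (λ x → T? (Q x)) (All.universal (λ x → subst T (sym (eq x)) tt) xs))
count-const Q {false} eq xs = cong length (filter-none (λ x → T? (Q x)) (All.universal (λ x → subst T (eq x)) xs))

-- Averaging over the first coordinate. A probability bound `1/c` is multiplied out so as to stay
-- within the natural numbers.
count-sections : ∀ (Q : C → Bool) (f : A → B → C) c xs ys →
  (∀ x → count (Q ∘ f x) ys * c ≤ length ys) →
  count Q (cartesianProductWith f xs ys) * c ≤ length (cartesianProductWith f xs ys)
count-sections Q f c [] ys h = z≤n
count-sections Q f c (x ∷ xs) ys h = begin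
  count Q (cartesianProductWith f (x ∷ xs) ys) * c
    ≡⟨ cong (_* c) (count-cartesianProductWith-∷ Q f x xs ys) ⟩
  (count (Q ∘ f x) ys + count Q (cartesianProductWith f xs ys)) * c
    ≡⟨ *-distribʳ-+ c (count (Q ∘ f x) ys) _ ⟩
  count (Q ∘ f x) ys * c + count Q (cartesianProductWith f xs ys) * c
    ≤⟨ +-mono-≤ (h x) (count-sections Q f c xs ys h) ⟩
  length ys + length (cartesianProductWith f xs ys)
    ≡⟨ length-cartesianProductWith-∷ f x xs ys ⟨
  length (cartesianProductWith f (x ∷ xs) ys) ∎
  where open ≤-Reasoning

-- For events decided by the first coordinate alone; this factors out the permutations that follow
-- the block being played.
count-cylinder : ∀ (Q : C → Bool) (R : A → Bool) (f : A → B → C) xs ys →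
  (∀ x y → Q (f x y) ≡ R x) →
  count Q (cartesianProductWith f xs ys) ≡ count R xs * length ys
count-cylinder Q R f [] ys h = refl
count-cylinder Q R f (x ∷ xs) ys h = begin
  count Q (cartesianProductWith f (x ∷ xs) ys)
    ≡⟨ count-cartesianProductWith-∷ Q f x xs ys ⟩
  count (Q ∘ f x) ys + count Q (cartesianProductWith f xs ys)
    ≡⟨ cong₂ _+_ (count-const (Q ∘ f x) (h x) ys) (count-cylinder Q R f xs ys h) ⟩
  (if R x then length ys else 0) + count R xs * length ys
    ≡⟨ step ⟩
  count R (x ∷ xs) * length ys ∎
  where
  open ≡-Reasoning
  step : (if R x then length ys else 0) + count R xs * length ys ≡ count R (x ∷ xs) * length ys
  step with R x
  ... | true  = refl
  ... | false = refl

-- Permutations as vectors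

T-if : ∀ {b c} → T (if b then c else true) → T b → T c
T-if {true} p _ = p

T-if⁺ : ∀ {b c} → (T b → T c) → T (if b then c else true)
T-if⁺ {true}  p = p tt
T-if⁺ {false} p = tt

LookupInjective : Vec A n → Set
LookupInjective v = ∀ {i j} → lookup v i ≡ lookup v j → i ≡ j

isPerm⇒injective : (v : Vec (Fin n) n) → T (isPerm v) → LookupInjective v
isPerm⇒injective v p {i} {j} eq =
  toWitness (T-if {b = eqF (lookup v i) (lookup v j)}
    (All.lookup (All.all⁺ _ _ (All.lookup (All.all⁺ _ _ p) (∈-allFin i))) (∈-allFin j))
    (fromWitness eq))

injective⇒isPerm : (v : Vec (Fin n) n) → LookupInjective v → T (isPerm v)
injective⇒isPerm {n} v inj =
  All.all⁻ _ {xs = allFin n} (All.universal (λ i →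
    All.all⁻ (λ j → if eqF (lookup v i) (lookup v j) then eqF i j else true) {xs = allFin n}
      (All.universal (λ j → T-if⁺ {b = eqF (lookup v i) (lookup v j)} (fromWitness ∘ inj ∘ toWitness)) _)) _)

∈-allVecs : ∀ {l} (v : Vec (Fin n) l) → v ∈ allVecs l
∈-allVecs Vec.[] = here refl
∈-allVecs (x Vec.∷ v) = ∈-cartesianProductWith⁺ Vec._∷_ (∈-allFin x) (∈-allVecs v)

allVecs-unique : ∀ l → Unique (allVecs {n} l)
allVecs-unique zero = [] ∷ []
allVecs-unique (suc l) =
  Unique.cartesianProductWith⁺ Vec._∷_ Vec.∷-injective (Unique.allFin⁺ _) (allVecs-unique l)

perms-unique : ∀ n → Unique (perms n)
perms-unique n = Unique.filter⁺ _ (allVecs-unique n)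

∈-perms⁺ : {v : Vec (Fin n) n} → LookupInjective v → v ∈ perms n
∈-perms⁺ {v = v} inj = ∈-filter⁺ (λ v → T? (isPerm v)) (∈-allVecs v) (injective⇒isPerm v inj)

∈-perms⁻ : {v : Vec (Fin n) n} → v ∈ perms n → LookupInjective v
∈-perms⁻ {v = v} v∈ = isPerm⇒injective v (proj₂ (∈-filter⁻ (λ v → T? (isPerm v)) {xs = allVecs _} v∈))

-- Transpositions of values and late vertices

transpose-left : ∀ (i j : Fin n) → transpose i j i ≡ j
transpose-left i j with i ≟ i
... | yes _  = refl
... | no i≢i = contradiction refl i≢i

transpose-right : ∀ (i j : Fin n) → transpose i j j ≡ i
transpose-right i j with j ≟ i
... | yes j≡i = j≡i
... | no _ with j ≟ j
...   | yes _  = refl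
...   | no j≢j = contradiction refl j≢j

transpose-fixed : ∀ {i j k : Fin n} → k ≢ i → k ≢ j → transpose i j k ≡ k
transpose-fixed {i = i} {j} {k} k≢i k≢j with k ≟ i
... | yes k≡i = contradiction k≡i k≢i
... | no _ with k ≟ j
...   | yes k≡j = contradiction k≡j k≢j
...   | no _ = refl

transpose-involutive : ∀ (i j k : Fin n) → transpose i j (transpose i j k) ≡ k
transpose-involutive i j k with k ≟ i
... | yes refl = transpose-right i j
... | no k≢i with k ≟ j
...   | yes refl = transpose-left i j
...   | no k≢j = transpose-fixed k≢i k≢j

transpose-injective : ∀ (i j : Fin n) {k l} → transpose i j k ≡ transpose i j l → k ≡ l
transpose-injective i j {k} {l} eq =
  trans (sym (transpose-involutive i j k)) (trans (cong (transpose i j) eq) (transpose-involutive i j l))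

-- The exchange acts on values: `a` trades places with whatever stands at position `i`. A
-- transposition is its own inverse, so `a` and the displaced value suffice to undo it, without the
-- former position of `a`.
bring : Fin n → Fin n → Vec (Fin n) n → Vec (Fin n) n
bring a i π = Vec.map (transpose a (lookup π i)) π

lookup-bring : ∀ a i (π : Vec (Fin n) n) → lookup (bring a i π) i ≡ a
lookup-bring a i π = trans (Vec.lookup-map i _ π) (transpose-right a (lookup π i))

bring-injective : ∀ a i (π : Vec (Fin n) n) → LookupInjective π → LookupInjective (bring a i π)
bring-injective a i π inj {k} {l} eq = inj (transpose-injective a (lookup π i) (begin
  transpose a (lookup π i) (lookup π k) ≡⟨ Vec.lookup-map k _ π ⟨
  lookup (bring a i π) k                ≡⟨ eq ⟩
  lookup (bring a i π) l                ≡⟨ Vec.lookup-map l _ π ⟩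
  transpose a (lookup π i) (lookup π l) ∎))
  where open ≡-Reasoning

unbring : ∀ a i (π : Vec (Fin n) n) → Vec.map (transpose a (lookup π i)) (bring a i π) ≡ π
unbring a i π = trans (sym (Vec.map-∘ t t π)) (trans (Vec.map-cong (transpose-involutive a (lookup π i)) π) (Vec.map-id π))
  where t = transpose a (lookup π i)

-- Positions are numbered from 0, so in a permutation the late vertices are those offered only after
-- the first `m` rounds of the block.
Late : ℕ → Vec (Fin n) n → Fin n → Set
Late m π v = ∃[ i ] m ≤ toℕ i × lookup π i ≡ v

-- Besides `a`, only the value displaced from `i` moves, and that one was late already because it
-- stood at `i`.
late-bring : ∀ {m a i} (π : Vec (Fin n) n) {w} → m ≤ toℕ i → w ≢ a →
             Late m (bring a i π) w → Late m π w
late-bring {a = a} {i} π m≤i w≢a (j , m≤j , refl) with lookup π j ≟ a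
... | yes eq = i , m≤i , sym (trans (Vec.lookup-map j _ π)
        (trans (cong (transpose a (lookup π i)) eq) (transpose-left a (lookup π i))))
... | no ≢a with lookup π j ≟ lookup π i
...   | yes eq = contradiction (trans (Vec.lookup-map j _ π)
          (trans (cong (transpose a (lookup π i)) eq) (transpose-right a (lookup π i)))) w≢a
...   | no ≢i = j , m≤j , sym (trans (Vec.lookup-map j _ π) (transpose-fixed ≢a ≢i))

-- Disjoint families of pairs and the switching bound

Disjoint : A × A → A × A → Set
Disjoint (a , b) (c , d) = (c ≢ a × c ≢ b) × (d ≢ a × d ≢ b)

allPairs-lookup : ∀ {R : A → A → Set} {xs x y} → AllPairs R xs → x ∈ xs → y ∈ xs → x ≡ y ⊎ R x y ⊎ R y x
allPairs-lookup (r ∷ rs) (here refl) (here refl) = inj₁ refl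
allPairs-lookup (r ∷ rs) (here refl) (there q) = inj₂ (inj₁ (All.lookup r q))
allPairs-lookup (r ∷ rs) (there p) (here refl) = inj₂ (inj₂ (All.lookup r p))
allPairs-lookup (r ∷ rs) (there p) (there q) = allPairs-lookup rs p q

disjoint-sym : ∀ {p q : A × A} → Disjoint p q → Disjoint q p
disjoint-sym ((c≢a , c≢b) , d≢a , d≢b) = (c≢a ∘ sym , d≢a ∘ sym) , c≢b ∘ sym , d≢b ∘ sym

disjoint-family : ∀ {F : List (A × A)} {p q} → AllPairs Disjoint F → p ∈ F → q ∈ F → p ≡ q ⊎ Disjoint p q
disjoint-family dis p∈F q∈F with allPairs-lookup dis p∈F q∈F
... | inj₁ p≡q = inj₁ p≡q
... | inj₂ (inj₁ d) = inj₂ d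
... | inj₂ (inj₂ d) = inj₂ (disjoint-sym d)

disjoint⇒unique : ∀ {F : List (A × A)} → AllPairs Disjoint F → Unique F
disjoint⇒unique [] = []
disjoint⇒unique (r ∷ rs) = All.map (λ { d refl → proj₁ (proj₁ d) refl }) r ∷ disjoint⇒unique rs

-- Switching: bring a pair of F to two late positions and remember the two
-- displaced values.  As the original permutation has no late pair, the pair can
-- be read off the result, and the exchanges can then be undone.
module Switching
  (m h : ℕ) (m+2h≤n : m + (h + h) ≤ n)
  (F : List (Fin n × Fin n)) (F-disjoint : AllPairs Disjoint F)
  (F-proper : ∀ {a b} → (a , b) ∈ F → a ≢ b)
  (Π : List (Vec (Fin n) n)) (Π-unique : Unique Π)
  (Π-perms : ∀ {π} → π ∈ Π → LookupInjective π)
  (Π-avoids : ∀ {π a b} → π ∈ Π → (a , b) ∈ F → Late m π a → Late m π b → a ≡ b)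
  where

  position : Fin (h + h) → Fin n
  position t = inject≤ (m ↑ʳ t) m+2h≤n

  position-injective : ∀ {s t} → position s ≡ position t → s ≡ t
  position-injective {s} {t} eq = Fin.↑ʳ-injective m s t (Fin.inject≤-injective m+2h≤n m+2h≤n _ _ eq)

  position-late : ∀ t → m ≤ toℕ (position t)
  position-late t = ≤-trans (m≤m+n m (toℕ t))
    (≤-reflexive (sym (trans (Fin.toℕ-inject≤ (m ↑ʳ t) m+2h≤n) (Fin.toℕ-↑ʳ m t))))

  -- The `2h` positions starting at `m` are split into two halves, one for each end of a pair, so
  -- that the second exchange never uses the position filled by the first.
  fst snd : Fin h → Fin n
  fst s = position (s ↑ˡ h)
  snd t = position (h ↑ʳ t)

  fst-injective : ∀ {s t} → fst s ≡ fst t → s ≡ t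
  fst-injective = Fin.↑ˡ-injective h _ _ ∘ position-injective

  snd-injective : ∀ {s t} → snd s ≡ snd t → s ≡ t
  snd-injective = Fin.↑ʳ-injective h _ _ ∘ position-injective

  fst≢snd : ∀ s t → fst s ≢ snd t
  fst≢snd s t eq = <⇒≱ (Fin.toℕ<n s) (begin
    h              ≤⟨ m≤m+n h (toℕ t) ⟩
    h + toℕ t      ≡⟨ Fin.toℕ-↑ʳ h t ⟨
    toℕ (h ↑ʳ t)   ≡⟨ cong toℕ (position-injective eq) ⟨
    toℕ (s ↑ˡ h)   ≡⟨ Fin.toℕ-↑ˡ s h ⟩
    toℕ s          ∎)
    where open ≤-Reasoning

  Datum : Set
  Datum = Vec (Fin n) n × ((Fin n × Fin n) × (Fin h × Fin h))

  middle : Datum → Vec (Fin n) n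
  middle (π , (a , b) , (s , t)) = bring a (fst s) π

  result : Datum → Vec (Fin n) n
  result x@(π , (a , b) , (s , t)) = bring b (snd t) (middle x)

  switch : Datum → Vec (Fin n) n × (Fin n × Fin n)
  switch x@(π , (a , b) , (s , t)) = result x , lookup π (fst s) , lookup (middle x) (snd t)

  data-list : List Datum
  data-list = cartesianProduct Π (cartesianProduct F (cartesianProduct (allFin h) (allFin h)))

  record Valid (x : Datum) : Set where
    field
      π∈Π : proj₁ x ∈ Π
      p∈F : proj₁ (proj₂ x) ∈ F

  valid : ∀ {x} → x ∈ data-list → Valid x
  valid x∈ with ∈-cartesianProduct⁻ Π _ x∈
  ... | π∈ , rest∈ = record { π∈Π = π∈ ; p∈F = proj₁ (∈-cartesianProduct⁻ F _ rest∈) }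

  middle-injective : ∀ {x} → Valid x → LookupInjective (middle x)
  middle-injective {π , (a , b) , (s , t)} v = bring-injective a (fst s) π (Π-perms (Valid.π∈Π v))

  result-injective : ∀ {x} → Valid x → LookupInjective (result x)
  result-injective {x@(π , (a , b) , (s , t))} v = bring-injective b (snd t) (middle x) (middle-injective v)

  result-snd : ∀ x → lookup (result x) (snd (proj₂ (proj₂ (proj₂ x)))) ≡ proj₂ (proj₁ (proj₂ x))
  result-snd x@(π , (a , b) , (s , t)) = lookup-bring b (snd t) (middle x)

  -- The second exchange moves only `b` and the value at `snd t`. The vertex `a` is neither: the
  -- pair is proper, and `middle x` has `a` at the different position `fst s`.
  result-fst : ∀ {x} → Valid x → lookup (result x) (fst (proj₁ (proj₂ (proj₂ x)))) ≡ proj₁ (proj₁ (proj₂ x))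
  result-fst {x@(π , (a , b) , (s , t))} v = begin
    lookup (result x) (fst s)                                        ≡⟨ Vec.lookup-map (fst s) _ (middle x) ⟩
    transpose b (lookup (middle x) (snd t)) (lookup (middle x) (fst s)) ≡⟨ cong (transpose b (lookup (middle x) (snd t))) eq ⟩
    transpose b (lookup (middle x) (snd t)) a                          ≡⟨ transpose-fixed (F-proper (Valid.p∈F v)) a≢ ⟩
    a ∎
    where
    open ≡-Reasoning
    eq : lookup (middle x) (fst s) ≡ a
    eq = lookup-bring a (fst s) π
    a≢ : a ≢ lookup (middle x) (snd t)
    a≢ a≡ = fst≢snd s t (middle-injective v (trans eq a≡))

  late-result : ∀ x {w} → w ≢ proj₁ (proj₁ (proj₂ x)) → w ≢ proj₂ (proj₁ (proj₂ x)) →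
                Late m (result x) w → Late m (proj₁ x) w
  late-result x@(π , (a , b) , (s , t)) w≢a w≢b =
    late-bring π (position-late _) w≢a ∘ late-bring (middle x) (position-late _) w≢b

  -- The pair of `y` sits at late positions of the common result. Were it disjoint from the pair of
  -- `x`, both its ends would already be late in the original permutation of `x`, against
  -- `Π-avoids`.
  same-pair : ∀ {x y} → Valid x → Valid y → result x ≡ result y → proj₁ (proj₂ x) ≡ proj₁ (proj₂ y)
  same-pair {x@(π , (a , b) , (s , t))} {y@(π′ , (c , d) , (s′ , t′))} vx vy eq
    with disjoint-family F-disjoint (Valid.p∈F vx) (Valid.p∈F vy)
  ... | inj₁ p≡q = p≡q
  ... | inj₂ ((c≢a , c≢b) , d≢a , d≢b) = contradiction
    (Π-avoids (Valid.π∈Π vx) (Valid.p∈F vy)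
      (late-result x c≢a c≢b (fst s′ , position-late _ , trans (cong (λ σ → lookup σ (fst s′)) eq) (result-fst vy)))
      (late-result x d≢a d≢b (snd t′ , position-late _ , trans (cong (λ σ → lookup σ (snd t′)) eq) (result-snd y))))
    (F-proper (Valid.p∈F vy))

  switch-injective : ∀ {x y} → Valid x → Valid y → switch x ≡ switch y → x ≡ y
  switch-injective {x@(π , (a , b) , (s , t))} {y@(π′ , (c , d) , (s′ , t′))} vx vy eq
    with refl ← same-pair vx vy (cong proj₁ eq)
    -- Values in the result are distinct, so the places of the two ends of the known pair reveal `s`
    -- and then `t`.
    with refl ← fst-injective (result-injective vx (trans (result-fst vx)
           (sym (trans (cong (λ σ → lookup σ (fst s′)) (cong proj₁ eq)) (result-fst vy)))))
    with refl ← snd-injective (result-injective vx (trans (result-snd x)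
           (sym (trans (cong (λ σ → lookup σ (snd t′)) (cong proj₁ eq)) (result-snd y)))))
    = cong (_, _) π≡π′
    where
    -- With the pair, the positions and the displaced values known, the exchanges are undone in
    -- reverse order.
    middle≡ : middle x ≡ middle y
    middle≡ = trans (sym (unbring b (snd t) (middle x)))
      (trans (cong₂ (λ σ v → Vec.map (transpose b v) σ) (cong proj₁ eq) (cong (proj₂ ∘ proj₂) eq))
             (unbring b (snd t) (middle y)))
    π≡π′ : π ≡ π′
    π≡π′ = trans (sym (unbring a (fst s) π))
      (trans (cong₂ (λ σ v → Vec.map (transpose a v) σ) middle≡ (cong (proj₁ ∘ proj₂) eq))
             (unbring a (fst s) π′))

  -- `switch` maps the `|Π| |F| h²` data injectively to a permutation together with two recorded
  -- values.
  switching-bound : length Π * (length F * (h * h)) ≤ length (perms n) * (n * n)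
  switching-bound = begin
    length Π * (length F * (h * h))  ≡⟨ cong (λ z → length Π * (length F * z)) (square h) ⟨
    length Π * (length F * length (cartesianProduct (allFin h) (allFin h)))
      ≡⟨ cong (length Π *_) (length-cartesianProductWith _,_ F _) ⟨
    length Π * length (cartesianProduct F (cartesianProduct (allFin h) (allFin h)))
      ≡⟨ length-cartesianProductWith _,_ Π _ ⟨
    length data-list
      ≤⟨ length-injective switch data-unique
           (λ x∈ → ∈-cartesianProduct⁺ (∈-perms⁺ (result-injective (valid x∈)))
                     (∈-cartesianProduct⁺ (∈-allFin _) (∈-allFin _)))
           (λ x∈ y∈ → switch-injective (valid x∈) (valid y∈)) ⟩
    length (cartesianProduct (perms n) (cartesianProduct (allFin n) (allFin n)))
      ≡⟨ length-cartesianProductWith _,_ (perms n) _ ⟩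
    length (perms n) * length (cartesianProduct (allFin n) (allFin n))
      ≡⟨ cong (length (perms n) *_) (square n) ⟩
    length (perms n) * (n * n) ∎
    where
    open ≤-Reasoning
    square : ∀ l → length (cartesianProduct (allFin l) (allFin l)) ≡ l * l
    square l = trans (length-cartesianProductWith _,_ (allFin l) (allFin l))
      (cong₂ _*_ (length-tabulate {n = l} id) (length-tabulate {n = l} id))
    data-unique : Unique data-list
    data-unique = Unique.cartesianProduct⁺ Π-unique (Unique.cartesianProduct⁺ (disjoint⇒unique F-disjoint)
      (Unique.cartesianProduct⁺ (Unique.allFin⁺ h) (Unique.allFin⁺ h)))

count-uniform : ∀ (Q : C → Bool) (f : A → B → C) d xs ys →
  (∀ x → count (Q ∘ f x) ys ≡ d) → count Q (cartesianProductWith f xs ys) ≡ length xs * d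
count-uniform Q f d [] ys h = refl
count-uniform Q f d (x ∷ xs) ys h =
  trans (count-cartesianProductWith-∷ Q f x xs ys) (cong₂ _+_ (h x) (count-uniform Q f d xs ys h))

-- Edges of the multigraph and offered vertices

hasEdge⁻ : ∀ es {a b : Fin n} → T (hasEdge es a b) → (a , b) ∈ es ⊎ (b , a) ∈ es
hasEdge⁻ ((x , y) ∷ es) {a} {b} p with to (T-∨ {(eqF x a ∧ eqF y b) ∨ (eqF x b ∧ eqF y a)}) p
... | inj₂ q = Sum.map there there (hasEdge⁻ es q)
... | inj₁ q with to (T-∨ {eqF x a ∧ eqF y b}) q
...   | inj₁ r with s , t ← to (T-∧ {eqF x a}) r with refl ← toWitness {a? = x ≟ a} s | refl ← toWitness {a? = y ≟ b} t = inj₁ (here refl)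
...   | inj₂ r with s , t ← to (T-∧ {eqF x b}) r with refl ← toWitness {a? = x ≟ b} s | refl ← toWitness {a? = y ≟ a} t = inj₂ (here refl)

hasEdge⁺ : ∀ es {a b : Fin n} → (a , b) ∈ es ⊎ (b , a) ∈ es → T (hasEdge es a b)
hasEdge⁺ ((a , b) ∷ es) (inj₁ (here refl)) =
  from T-∨ (inj₁ (from T-∨ (inj₁ (from T-∧ (fromWitness {a? = a ≟ a} refl , fromWitness {a? = b ≟ b} refl)))))
hasEdge⁺ ((b , a) ∷ es) (inj₂ (here refl)) =
  from T-∨ (inj₁ (from (T-∨ {eqF b a ∧ eqF a b})
    (inj₂ (from T-∧ (fromWitness {a? = b ≟ b} refl , fromWitness {a? = a ≟ a} refl)))))
hasEdge⁺ ((x , y) ∷ es) {a} {b} (inj₁ (there p)) =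
  from (T-∨ {(eqF x a ∧ eqF y b) ∨ (eqF x b ∧ eqF y a)}) (inj₂ (hasEdge⁺ es (inj₁ p)))
hasEdge⁺ ((x , y) ∷ es) {a} {b} (inj₂ (there p)) =
  from (T-∨ {(eqF x a ∧ eqF y b) ∨ (eqF x b ∧ eqF y a)}) (inj₂ (hasEdge⁺ es (inj₂ p)))

hasEdge-sym : ∀ es {a b : Fin n} → T (hasEdge es a b) → T (hasEdge es b a)
hasEdge-sym es = hasEdge⁺ es ∘ Sum.swap ∘ hasEdge⁻ es

containsG⁻ : ∀ (G : Graph n) es → T (containsG G es) → ∀ {a b} → T (adj G a b) → T (hasEdge es a b)
containsG⁻ G es p {a} {b} =
  T-if (All.lookup (All.all⁺ _ _ (All.lookup (All.all⁺ _ _ p) (∈-allFin a))) (∈-allFin b))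

adj-sym : ∀ (G : Graph n) {a b} → T (adj G a b) → T (adj G b a)
adj-sym G {a} {b} = subst T (Graph.sym G a b)

edgesFrom-++ : ∀ (S : Strategy n) hist vs ws →
  edgesFrom S hist (vs ++ ws) ≡ edgesFrom S hist vs ++ edgesFrom S (hist ++ vs) ws
edgesFrom-++ S hist [] ws = cong (λ h → edgesFrom S h ws) (sym (++-identityʳ hist))
edgesFrom-++ S hist (v ∷ vs) ws = cong (_ ∷_) (trans (edgesFrom-++ S (hist ++ [ v ]) vs ws)
  (cong (λ h → edgesFrom S (hist ++ [ v ]) vs ++ edgesFrom S h ws) (++-assoc hist [ v ] vs)))

-- Through this, distinctness of the vertices offered within a block passes to the edges built
-- there.
map-proj₂-edgesFrom : ∀ (S : Strategy n) hist vs → map proj₂ (edgesFrom S hist vs) ≡ vs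
map-proj₂-edgesFrom S hist [] = refl
map-proj₂-edgesFrom S hist (v ∷ vs) = cong (v ∷_) (map-proj₂-edgesFrom S (hist ++ [ v ]) vs)

length-edgesFrom : ∀ (S : Strategy n) hist vs → length (edgesFrom S hist vs) ≡ length vs
length-edgesFrom S hist vs =
  trans (sym (length-map proj₂ (edgesFrom S hist vs))) (cong length (map-proj₂-edgesFrom S hist vs))

∈-take-toList⁻ : ∀ {l} (π : Vec A l) m {v} → v ∈ take m (toList π) → ∃[ i ] toℕ i < m × lookup π i ≡ v
∈-take-toList⁻ (x Vec.∷ π) (suc m) (here refl) = Fin.zero , s≤s z≤n , refl
∈-take-toList⁻ (x Vec.∷ π) (suc m) (there p) with i , i<m , eq ← ∈-take-toList⁻ π m p = Fin.suc i , s≤s i<m , eq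

toList-tabulate : ∀ {l} (π : Vec A l) → toList π ≡ List.tabulate (lookup π)
toList-tabulate Vec.[] = refl
toList-tabulate (x Vec.∷ π) = cong (x ∷_) (toList-tabulate π)

unique-toList : ∀ {π : Vec (Fin n) n} → LookupInjective π → Unique (toList π)
unique-toList {π = π} inj = subst Unique (sym (toList-tabulate π)) (Unique.tabulate⁺ inj)

unique-map⁻ : ∀ (f : A → B) {xs x y} → Unique (map f xs) → x ∈ xs → y ∈ xs → f x ≡ f y → x ≡ y
unique-map⁻ f (_ ∷ _) (here refl) (here refl) _ = refl
unique-map⁻ f (x∉ ∷ _) (here refl) (there q) eq = contradiction eq (All.lookup x∉ (∈-map⁺ f q))
unique-map⁻ f (x∉ ∷ _) (there p) (here refl) eq = contradiction (sym eq) (All.lookup x∉ (∈-map⁺ f p))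
unique-map⁻ f (_ ∷ u) (there p) (there q) eq = unique-map⁻ f u p q eq

unique-map-filter : ∀ (f : A → B) {P : A → Set} (P? : Decidable P) {xs} →
  Unique (map f xs) → Unique (map f (filter P? xs))
unique-map-filter f P? = AllPairs.map⁺ ∘ AllPairs.filter⁺ P? ∘ AllPairs.map⁻

-- Maximal disjoint families

ends : List (A × A) → List A
ends F = map proj₁ F ++ map proj₂ F

length-ends : (F : List (A × A)) → length (ends F) ≡ length F + length F
length-ends F = trans (length-++ (map proj₁ F)) (cong₂ _+_ (length-map proj₁ F) (length-map proj₂ F))

module _ {n : ℕ} where

  open DecMembership (_≟_ {n}) using (_∈?_)

  -- A pair with neither entry covered is added and every other one skipped, so `F` cannot be
  -- extended. Maximality is recorded as covering, the form that the charging argument uses.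
  greedy : ∀ (cs : List (Fin n × Fin n)) → ∃[ F ] (∀ {c} → c ∈ F → c ∈ cs) × AllPairs Disjoint F ×
           (∀ {a b} → (a , b) ∈ cs → a ∈ ends F ⊎ b ∈ ends F)
  greedy [] = [] , (λ ()) , [] , λ ()
  greedy ((a , b) ∷ cs) with greedy cs
  ... | F , F⊆cs , dis , maximal with a ∈? ends F | b ∈? ends F
  ...   | yes a∈ | _ = F , there ∘ F⊆cs , dis , λ { (here refl) → inj₁ a∈ ; (there p) → maximal p }
  ...   | no _ | yes b∈ = F , there ∘ F⊆cs , dis , λ { (here refl) → inj₂ b∈ ; (there p) → maximal p }
  ...   | no a∉ | no b∉ =
    (a , b) ∷ F ,
    (λ { (here refl) → here refl ; (there p) → there (F⊆cs p) }) ,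
    All.tabulate (λ p → (missˡ a∉ p , missˡ b∉ p) , (missʳ a∉ p , missʳ b∉ p)) ∷ dis ,
    λ { (here refl) → inj₁ (here refl) ; (there p) → Sum.map grow grow (maximal p) }
    where
    missˡ : ∀ {v p} → v ∉ ends F → p ∈ F → proj₁ p ≢ v
    missˡ v∉ p refl = v∉ (∈-++⁺ˡ (∈-map⁺ proj₁ p))
    missʳ : ∀ {v p} → v ∉ ends F → p ∈ F → proj₂ p ≢ v
    missʳ v∉ p refl = v∉ (∈-++⁺ʳ (map proj₁ F) (∈-map⁺ proj₂ p))
    grow : ∀ {v} → v ∈ ends F → v ∈ ends ((a , b) ∷ F)
    grow v∈ with ∈-++⁻ (map proj₁ F) v∈
    ... | inj₁ p = there (∈-++⁺ˡ p)
    ... | inj₂ p = there (∈-++⁺ʳ (map proj₁ F) (there p))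

-- Open edges and conflicts before the last block

module Residual {n : ℕ} (G : Graph n) (built : List (Fin n × Fin n)) where

  open DecMembership (_≟_ {n}) using (_∈?_)

  Open : Fin n → Fin n → Set
  Open a b = T (adj G a b) × ¬ T (hasEdge built a b)

  Open? : ∀ a b → Dec (Open a b)
  Open? a b = T? (adj G a b) ×-dec ¬? (T? (hasEdge built a b))

  open-sym : ∀ {a b} → Open a b → Open b a
  open-sym (p , q) = adj-sym G p , q ∘ hasEdge-sym built

  open-proper : ∀ {a b} → Open a b → a ≢ b
  open-proper {a} (p , _) refl = subst T (irrefl G a) p

  openEdges : List (Fin n × Fin n) → List (Fin n × Fin n)
  openEdges = filter (λ e → Open? (proj₁ e) (proj₂ e))

  -- Two vertices at most one of which can remain unoffered in the last block.
  Conflict : Fin n → Fin n → Set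
  Conflict a b = a ≢ b × (Open a b ⊎ ∃[ x ] Open x a × Open x b)

  Conflict? : ∀ a b → Dec (Conflict a b)
  Conflict? a b = ¬? (a ≟ b) ×-dec (Open? a b ⊎-dec Fin.any? (λ x → Open? x a ×-dec Open? x b))

  conflicts : List (Fin n × Fin n)
  conflicts = filter (λ e → Conflict? (proj₁ e) (proj₂ e)) (cartesianProduct (allFin n) (allFin n))

  ∈-conflicts⁺ : ∀ {a b} → Conflict a b → (a , b) ∈ conflicts
  ∈-conflicts⁺ = ∈-filter⁺ (λ e → Conflict? (proj₁ e) (proj₂ e)) (∈-cartesianProduct⁺ (∈-allFin _) (∈-allFin _))

  ∈-conflicts⁻ : ∀ {a b} → (a , b) ∈ conflicts → Conflict a b
  ∈-conflicts⁻ p = proj₂ (∈-filter⁻ (λ e → Conflict? (proj₁ e) (proj₂ e)) {xs = cartesianProduct (allFin n) (allFin n)} p)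

  -- An open edge is charged to its offered end if F covers that end, and
  -- otherwise to the other one.
  maximal-family-size : ∀ (F L : List (Fin n × Fin n)) →
    (∀ {a b} → Conflict a b → a ∈ ends F ⊎ b ∈ ends F) →
    Unique (map proj₂ L) → (∀ {x v} → (x , v) ∈ L → Open x v) →
    length L ≤ 4 * length F
  maximal-family-size F L maximal L! L-open = begin
    length L
      -- `inj₁` marks a charge to the offered end and `inj₂` one to the other end, so each of the
      -- `2|F|` covered vertices is available twice.
      ≤⟨ length-injective charge (Unique.map⁻ L!) into injective ⟩
    length (map inj₁ (ends F) ++ map inj₂ (ends F))
      ≡⟨ trans (length-++ (map inj₁ (ends F))) (cong₂ _+_ (length-map inj₁ (ends F)) (length-map inj₂ (ends F))) ⟩
    length (ends F) + length (ends F)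
      ≡⟨ cong₂ _+_ (length-ends F) (length-ends F) ⟩
    length F + length F + (length F + length F)
      ≡⟨ four (length F) ⟩
    4 * length F ∎
    where
    open ≤-Reasoning

    four : ∀ l → l + l + (l + l) ≡ 4 * l
    four = solve-∀

    charge : Fin n × Fin n → Fin n ⊎ Fin n
    charge (x , v) with v ∈? ends F
    ... | yes _ = inj₁ v
    ... | no _  = inj₂ x

    into : ∀ {e} → e ∈ L → charge e ∈ map inj₁ (ends F) ++ map inj₂ (ends F)
    into {x , v} e∈L with v ∈? ends F
    ... | yes v∈ = ∈-++⁺ˡ (∈-map⁺ inj₁ v∈)
    -- The open edge is itself a conflict, so if `v` is uncovered then `x` is covered.
    ... | no v∉ with maximal (open-proper (L-open e∈L) , inj₁ (L-open e∈L))
    ...   | inj₁ x∈ = ∈-++⁺ʳ (map inj₁ (ends F)) (∈-map⁺ inj₂ x∈)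
    ...   | inj₂ v∈ = contradiction v∈ v∉

    injective : ∀ {d e} → d ∈ L → e ∈ L → charge d ≡ charge e → d ≡ e
    injective {x , v} {y , w} d∈L e∈L eq with v ∈? ends F | w ∈? ends F
    ... | yes _ | yes _ = unique-map⁻ proj₂ L! d∈L e∈L (inj₁-injective eq)
    ... | yes _ | no _  = contradiction eq λ ()
    ... | no _  | yes _ = contradiction eq λ ()
    -- Both edges are charged to the same `x`. Distinct offered ends would have `x` as a common open
    -- neighbour and so form a conflict that `F` misses.
    ... | no v∉ | no w∉ with refl ← inj₂-injective eq with v ≟ w
    ...   | yes refl = refl
    ...   | no v≢w = contradiction (maximal (v≢w , inj₂ (x , L-open d∈L , L-open e∈L))) [ v∉ , w∉ ]′

  completes⇒open∈ : ∀ {es} → T (containsG G (built ++ es)) → ∀ {a b} → Open a b → (a , b) ∈ es ⊎ (b , a) ∈ es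
  completes⇒open∈ {es} c (p , q) with hasEdge⁻ (built ++ es) (containsG⁻ G (built ++ es) c p)
  ... | inj₁ r = inj₁ ([ (λ r → contradiction (hasEdge⁺ built (inj₁ r)) q) , id ]′ (∈-++⁻ built r))
  ... | inj₂ r = inj₂ ([ (λ r → contradiction (hasEdge⁺ built (inj₂ r)) q) , id ]′ (∈-++⁻ built r))

  -- Counts ordered adjacent pairs, of which regularity gives `n * d`. Each is realised, in one
  -- direction or the other, by an edge of `built`, or else is open and realised in `es`.
  edge-count : ∀ {d es} → Regular G d → T (containsG G (built ++ es)) →
    n * d ≤ 2 * length built + 2 * length (openEdges es)
  edge-count {d} {es} regular c = begin
    n * d                      ≡⟨ cong (_* d) (length-tabulate {n = n} id) ⟨
    length (allFin n) * d      ≡⟨ count-uniform isEdge _,_ d (allFin n) (allFin n) degree ⟨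
    length (filter (λ e → T? (isEdge e)) (cartesianProduct (allFin n) (allFin n)))
      ≤⟨ length-injective id (Unique.filter⁺ _ (Unique.cartesianProduct⁺ (Unique.allFin⁺ n) (Unique.allFin⁺ n))) into (λ _ _ → id) ⟩
    length (both built ++ both (openEdges es))
      ≡⟨ trans (length-++ (both built)) (cong₂ _+_ (length-both built) (length-both (openEdges es))) ⟩
    2 * length built + 2 * length (openEdges es) ∎
    where
    open ≤-Reasoning

    isEdge : Fin n × Fin n → Bool
    isEdge (a , b) = adj G a b

    both : List (Fin n × Fin n) → List (Fin n × Fin n)
    both xs = xs ++ map swap xs

    length-both : ∀ xs → length (both xs) ≡ 2 * length xs
    length-both xs = trans (length-++ xs)
      (cong (length xs +_) (trans (length-map swap xs) (sym (+-identityʳ _))))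

    ∈-both : ∀ {a b xs} → (a , b) ∈ xs ⊎ (b , a) ∈ xs → (a , b) ∈ both xs
    ∈-both (inj₁ p) = ∈-++⁺ˡ p
    ∈-both {xs = xs} (inj₂ p) = ∈-++⁺ʳ xs (∈-map⁺ swap p)

    degree : ∀ a → count (adj G a) (allFin n) ≡ d
    degree a = trans (cong length (filter-≐ _ _ (to T-≡ , from T-≡) (allFin n))) (regular a)

    into : ∀ {e} → e ∈ filter (λ e → T? (isEdge e)) (cartesianProduct (allFin n) (allFin n)) →
           e ∈ both built ++ both (openEdges es)
    into {a , b} e∈ with proj₂ (∈-filter⁻ (λ e → T? (isEdge e)) {xs = cartesianProduct (allFin n) (allFin n)} e∈)
                       | T? (hasEdge built a b)
    ... | p | yes q = ∈-++⁺ˡ (∈-both (hasEdge⁻ built q))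
    ... | p | no q = ∈-++⁺ʳ (both built) (∈-both (Sum.map
      (λ r → ∈-filter⁺ (λ e → Open? (proj₁ e) (proj₂ e)) r (p , q))
      (λ r → ∈-filter⁺ (λ e → Open? (proj₁ e) (proj₂ e)) r (open-sym (p , q)))
      (completes⇒open∈ c (p , q))))

  -- An open edge at a late vertex can only be built when its other end is offered. Hence an open
  -- edge between two late vertices never appears, and a common open neighbour of two late vertices
  -- would have to be offered twice in the block.
  late-no-conflict : ∀ (S : Strategy n) hist m π → LookupInjective π →
    T (containsG G (built ++ edgesFrom S hist (take m (toList π)))) →
    ∀ {a b} → Late m π a → Late m π b → ¬ Conflict a b
  late-no-conflict S hist m π inj c {a} {b} late-a late-b (a≢b , conflict) = case-conflict conflict
    where
    es = edgesFrom S hist (take m (toList π))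

    es! : Unique (map proj₂ es)
    es! = subst Unique (sym (map-proj₂-edgesFrom S hist _)) (Unique.take⁺ m (unique-toList inj))

    not-head : ∀ {x v} → Late m π v → (x , v) ∉ es
    not-head {v = v} (i , m≤i , eq) e∈
      with j , j<m , eq′ ← ∈-take-toList⁻ π m (subst (v ∈_) (map-proj₂-edgesFrom S hist _) (∈-map⁺ proj₂ e∈))
      with refl ← inj (trans eq (sym eq′)) = <⇒≱ j<m m≤i

    tail : ∀ {x v} → Late m π v → Open x v → (v , x) ∈ es
    tail late o = [ (λ p → contradiction p (not-head late)) , id ]′ (completes⇒open∈ c o)

    case-conflict : ¬ (Open a b ⊎ ∃[ x ] Open x a × Open x b)
    case-conflict (inj₁ o) = not-head late-a (tail late-b o)
    case-conflict (inj₂ (x , oa , ob)) =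
      a≢b (cong proj₁ (unique-map⁻ proj₂ es! (tail late-a oa) (tail late-b ob) refl))

-- Conditional bound for the last block

-- The strategy is deterministic, so fixing the vertices offered in the first `k` blocks fixes the
-- edges built there, and only the order `π` of the next block is random.
final-block-bound : ∀ (G : Graph n) (S : Strategy n) {k e m h} .{{_ : NonZero n}} hist →
  Regular G (2 * k + 1) → length hist ≡ k * n → m + (h + h) ≤ n → 8 * (e + 1) * n ≤ h * h →
  count (λ π → containsG G (edges S hist ++ edgesFrom S hist (take m (toList π)))) (perms n) * (e + 1)
    ≤ length (perms n)
final-block-bound {n} G S {k} {e} {m} {h} hist regular |hist| m+2h≤n 8en≤hh = main
  where
  open Residual G (edges S hist)
  open ≤-Reasoning

  block : Vec (Fin n) n → List (Fin n × Fin n)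
  block π = edgesFrom S hist (take m (toList π))

  wins : Vec (Fin n) n → Bool
  wins π = containsG G (edges S hist ++ block π)

  winning : List (Vec (Fin n) n)
  winning = filter (λ π → T? (wins π)) (perms n)

  ∈-winning⁻ : ∀ {π} → π ∈ winning → LookupInjective π × T (wins π)
  ∈-winning⁻ π∈ with p , q ← ∈-filter⁻ (λ π → T? (wins π)) {xs = perms n} π∈ = ∈-perms⁻ p , q

  -- `F` depends only on the history. A single winning order shows that `F` is large, and switching
  -- then bounds the number of all winning orders.
  bound : ∀ {π} → π ∈ winning → length winning * (e + 1) ≤ length (perms n)
  bound {π} π∈ with inj , win ← ∈-winning⁻ π∈ with F , F⊆ , F-disjoint , maximal ← greedy conflicts =
    *-cancelʳ-≤ _ _ (n * n) {{m*n≢0 n n}} (begin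
      length winning * (e + 1) * (n * n)   ≡⟨ *-assoc (length winning) (e + 1) (n * n) ⟩
      length winning * ((e + 1) * (n * n)) ≤⟨ *-monoʳ-≤ (length winning) size ⟩
      length winning * (length F * (h * h)) ≤⟨ switching-bound ⟩
      length (perms n) * (n * n)           ∎)
    where
    avoids : ∀ {π a b} → π ∈ winning → (a , b) ∈ F → Late m π a → Late m π b → a ≡ b
    avoids π∈ p∈ late-a late-b with inj , win ← ∈-winning⁻ π∈ =
      contradiction (∈-conflicts⁻ (F⊆ p∈)) (late-no-conflict S hist m _ inj win late-a late-b)

    open Switching m h m+2h≤n F F-disjoint (proj₁ ∘ ∈-conflicts⁻ ∘ F⊆) winning
      (Unique.filter⁺ _ (perms-unique n)) (proj₁ ∘ ∈-winning⁻) avoids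

    L : List (Fin n × Fin n)
    L = openEdges (block π)

    L! : Unique (map proj₂ L)
    L! = unique-map-filter proj₂ _ (subst Unique (sym (map-proj₂-edgesFrom S hist _)) (Unique.take⁺ m (unique-toList inj)))

    |L|≤4|F| : length L ≤ 4 * length F
    |L|≤4|F| = maximal-family-size F L (maximal ∘ ∈-conflicts⁺) L!
      (λ p → proj₂ (∈-filter⁻ (λ e → Open? (proj₁ e) (proj₂ e)) {xs = block π} p))

    -- There are `n(2k+1) = 2kn + n` ordered adjacent pairs, and the `kn` edges built before the
    -- block account for at most `2kn` of them.
    n≤2|L| : n ≤ 2 * length L
    n≤2|L| = +-cancelˡ-≤ (2 * (k * n)) _ _ (begin
      2 * (k * n) + n                                ≡⟨ expand n k ⟩
      n * (2 * k + 1)                                ≤⟨ edge-count regular win ⟩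
      2 * length (edges S hist) + 2 * length L       ≡⟨ cong (λ l → 2 * l + 2 * length L) (trans (length-edgesFrom S [] hist) |hist|) ⟩
      2 * (k * n) + 2 * length L                     ∎)
      where
      expand : ∀ n k → 2 * (k * n) + n ≡ n * (2 * k + 1)
      expand = solve-∀

    size : (e + 1) * (n * n) ≤ length F * (h * h)
    size = begin
      (e + 1) * (n * n)                    ≡⟨ *-assoc (e + 1) n n ⟨
      -- The factor 8 arises from `n ≤ 2|L| ≤ 8|F|`.
      (e + 1) * n * n                      ≤⟨ *-monoʳ-≤ ((e + 1) * n) (≤-trans n≤2|L| (*-monoʳ-≤ 2 |L|≤4|F|)) ⟩
      (e + 1) * n * (2 * (4 * length F))   ≡⟨ regroup e n (length F) ⟩
      length F * (8 * (e + 1) * n)         ≤⟨ *-monoʳ-≤ (length F) 8en≤hh ⟩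
      length F * (h * h)                   ∎
      where
      regroup : ∀ e n l → (e + 1) * n * (2 * (4 * l)) ≡ l * (8 * (e + 1) * n)
      regroup = solve-∀

  main : length winning * (e + 1) ≤ length (perms n)
  main = cases winning refl
    where
    -- If no order wins, the left side is zero; otherwise any winning order can be passed to
    -- `bound`.
    cases : ∀ ws → winning ≡ ws → length winning * (e + 1) ≤ length (perms n)
    cases [] eq = subst (λ ws → length ws * (e + 1) ≤ length (perms n)) (sym eq) z≤n
    cases (π ∷ _) eq = bound (subst (π ∈_) (sym eq) (here refl))

-- From the last block to the whole process

take-++-≥ : ∀ {m} (xs ys : List A) → length xs ≤ m → take m (xs ++ ys) ≡ xs ++ take (m ∸ length xs) ys
take-++-≥ [] ys _ = refl
take-++-≥ (x ∷ xs) ys (s≤s le) = cong (x ∷_) (take-++-≥ xs ys le)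

take-++-≤ : ∀ {m} (xs ys : List A) → m ≤ length xs → take m (xs ++ ys) ≡ take m xs
take-++-≤ {m = zero} xs ys _ = refl
take-++-≤ {m = suc m} (x ∷ xs) ys (s≤s le) = cong (x ∷_) (take-++-≤ xs ys le)

length-concatMap-toList : ∀ (hs : List (Vec A n)) → length (concatMap toList hs) ≡ length hs * n
length-concatMap-toList [] = refl
length-concatMap-toList (h ∷ hs) = trans (length-++ (toList h)) (cong₂ _+_ (Vec.length-toList h) (length-concatMap-toList hs))

offered-block : ∀ {m} (hs : List (Vec (Fin n) n)) π ps → length hs * n ≤ m → m ≤ n + length hs * n →
  offered m (hs ++ π ∷ ps) ≡ concatMap toList hs ++ take (m ∸ length hs * n) (toList π)
offered-block {n} {m} hs π ps lo hi = begin
  take m (concatMap toList (hs ++ π ∷ ps))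
    ≡⟨ cong (take m) (concatMap-++ toList hs (π ∷ ps)) ⟩
  take m (concatMap toList hs ++ toList π ++ concatMap toList ps)
    ≡⟨ take-++-≥ (concatMap toList hs) _ (subst (_≤ m) (sym |hs|) lo) ⟩
  concatMap toList hs ++ take (m ∸ length (concatMap toList hs)) (toList π ++ concatMap toList ps)
    ≡⟨ cong (λ l → concatMap toList hs ++ take (m ∸ l) (toList π ++ concatMap toList ps)) |hs| ⟩
  concatMap toList hs ++ take (m ∸ length hs * n) (toList π ++ concatMap toList ps)
    ≡⟨ cong (concatMap toList hs ++_) (take-++-≤ (toList π) _ (subst (m ∸ length hs * n ≤_) (sym (Vec.length-toList π))
         (m≤n+o⇒m∸n≤o m (length hs * n) (≤-trans hi (≤-reflexive (+-comm n _)))))) ⟩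
  concatMap toList hs ++ take (m ∸ length hs * n) (toList π) ∎
  where
  open ≡-Reasoning
  |hs| = length-concatMap-toList hs

-- Conditions on the first `k` blocks one permutation at a time; `Q ∘ (π ∷_)` carries the part
-- already fixed.
count-permSeqs : ∀ {n} k r c (Q : List (Vec (Fin n) n) → Bool) →
  (∀ hs → length hs ≡ k → count (λ ps → Q (hs ++ ps)) (permSeqs n r) * c ≤ length (permSeqs n r)) →
  count Q (permSeqs n (k + r)) * c ≤ length (permSeqs n (k + r))
count-permSeqs zero r c Q h = h [] refl
count-permSeqs {n} (suc k) r c Q h = count-sections Q _∷_ c (perms n) (permSeqs n (k + r))
  (λ π → count-permSeqs k r c (Q ∘ (π ∷_)) (λ hs |hs| → h (π ∷ hs) (cong suc |hs|)))

-- Of the `m` sampled permutations the first `k` form the history and the next one the block being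
-- played. These `k + 1` decide the event, and the other `r` contribute a common factor.
goodCount-late : ∀ (G : Graph n) (S : Strategy n) {k e r h} .{{_ : NonZero n}} → let m = k + suc r in
  Regular G (2 * k + 1) → k * n ≤ m → m + (h + h) ≤ n + k * n → 8 * (e + 1) * n ≤ h * h →
  goodCount G S m * (e + 1) ≤ totalCount n m
goodCount-late {n} G S {k} {e} {r} {h} regular lo hi 8en≤hh =
  count-permSeqs k (suc r) (e + 1) (tauLe G S m) section
  where
  open ≤-Reasoning
  m = k + suc r

  section : ∀ hs → length hs ≡ k →
    count (λ ps → tauLe G S m (hs ++ ps)) (permSeqs n (suc r)) * (e + 1) ≤ length (permSeqs n (suc r))
  section hs refl = begin
    count (λ ps → tauLe G S m (hs ++ ps)) (permSeqs n (suc r)) * (e + 1)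
      ≡⟨ cong (_* (e + 1)) (count-cylinder _ wins _∷_ (perms n) (permSeqs n r) split) ⟩
    count wins (perms n) * length (permSeqs n r) * (e + 1)
      ≡⟨ *-right-comm (count wins (perms n)) (length (permSeqs n r)) (e + 1) ⟩
    count wins (perms n) * (e + 1) * length (permSeqs n r)
      ≤⟨ *-monoˡ-≤ (length (permSeqs n r)) (final-block-bound G S {k = k} {e} {h = h} hist regular (length-concatMap-toList hs) room 8en≤hh) ⟩
    length (perms n) * length (permSeqs n r)
      ≡⟨ length-cartesianProductWith _∷_ (perms n) (permSeqs n r) ⟨
    length (permSeqs n (suc r)) ∎
    where
    hist = concatMap toList hs

    wins : Vec (Fin n) n → Bool
    wins π = containsG G (edges S hist ++ edgesFrom S hist (take (m ∸ k * n) (toList π)))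

    split : ∀ π ps → tauLe G S m (hs ++ π ∷ ps) ≡ wins π
    split π ps = cong (containsG G) (trans
      (cong (edges S) (offered-block hs π ps lo (≤-trans (m≤m+n m _) hi)))
      (edgesFrom-++ S [] hist (take (m ∸ k * n) (toList π))))

    room : m ∸ k * n + (h + h) ≤ n
    room = begin
      m ∸ k * n + (h + h)   ≡⟨ +-∸-comm (h + h) lo ⟨
      m + (h + h) ∸ k * n   ≤⟨ ∸-monoˡ-≤ (k * n) hi ⟩
      n + k * n ∸ k * n     ≡⟨ m+n∸n≡m n (k * n) ⟩
      n ∎

    *-right-comm : ∀ a b c → a * b * c ≡ a * c * b
    *-right-comm = solve-∀

-- Rounds up to `kn`, and the choice of constants

-- Each round adds one edge, while `G` has `kn + n/2 > kn` of them.
goodCount-early : ∀ (G : Graph n) (S : Strategy n) {k m} .{{_ : NonZero n}} →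
  Regular G (2 * k + 1) → m ≤ k * n → goodCount G S m ≡ 0
goodCount-early {n} G S {k} {m} regular m≤kn =
  cong length (filter-none (λ ps → T? (tauLe G S m ps)) (All.universal never (permSeqs n m)))
  where
  open ≤-Reasoning
  never : ∀ ps → ¬ T (tauLe G S m ps)
  never ps win = n≮n (n * (2 * k + 1)) (begin-strict
    -- The whole multigraph is taken as `built`, followed by no further edges, so the term for
    -- `openEdges` vanishes.
    n * (2 * k + 1)                            ≤⟨ Residual.edge-count G es regular (subst (T ∘ containsG G) (sym (++-identityʳ es)) win) ⟩
    2 * length es + 0                          ≡⟨ +-identityʳ _ ⟩
    2 * length es                              ≡⟨ cong (2 *_) (length-edgesFrom S [] (offered m ps)) ⟩
    2 * length (offered m ps)                  ≤⟨ *-monoʳ-≤ 2 (≤-trans (≤-reflexive (length-take m (concatMap toList ps))) (m⊓n≤m m (length (concatMap toList ps)))) ⟩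
    2 * m                                      ≤⟨ *-monoʳ-≤ 2 m≤kn ⟩
    2 * (k * n)                                <⟨ m<m+n (2 * (k * n)) (>-nonZero⁻¹ n) ⟩
    2 * (k * n) + n                            ≡⟨ expand n k ⟩
    n * (2 * k + 1)                            ∎)
    where
    es = edges S (offered m ps)
    expand : ∀ n k → 2 * (k * n) + n ≡ n * (2 * k + 1)
    expand = solve-∀

-- High probability is expressed by bounding the chance of finishing too early by `1/(e+1)` for
-- every `e`, and the growth of `f` by comparing squares. The threshold depends only on `f` and `e`,
-- so the bound is uniform in `k`, `G`, `S` and `m`.
theorem7p1 : (f : ℕ → ℕ)
    → (∀ C → ∃[ N ] ∀ n → N ≤ n → C * n ≤ f n * f n)
    → ∀ e → ∃[ N ] ∀ n → N ≤ n → 2 ∣ n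
    → ∀ k → 1 ≤ k → 2 * k + 2 ≤ n
    → (G : Graph n) → Regular G (2 * k + 1)
    → (S : Strategy n) → ∀ m → m + f n < (k + 1) * n
    → goodCount G S m * (e + 1) ≤ totalCount n m
-- Here 32 is 4 times 8: the last block needs `8(e+1)n ≤ h²`, and `f n ≤ 2h` gives `(f n)² ≤ 4h²`.
theorem7p1 f f²≫n e with f²≫n (32 * (e + 1))
... | N , large = N , bound
  where
  open ≤-Reasoning
  bound : ∀ n → N ≤ n → 2 ∣ n → ∀ k → 1 ≤ k → 2 * k + 2 ≤ n → (G : Graph n) → Regular G (2 * k + 1) →
          (S : Strategy n) → ∀ m → m + f n < (k + 1) * n → goodCount G S m * (e + 1) ≤ totalCount n m
  bound zero _ _ k _ 2k+2≤0 = contradiction (≤-trans (m≤n+m 2 (2 * k)) 2k+2≤0) λ ()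
  bound n@(suc n-1) N≤n _ k _ _ G regular S m m+f< with m ≤? k * n
  ... | yes m≤kn = subst (λ c → c * (e + 1) ≤ totalCount n m) (sym (goodCount-early G S {k} regular m≤kn)) z≤n
  ... | no m≰kn = subst (λ m → goodCount G S m * (e + 1) ≤ totalCount n m) k+1+r≡m
    (goodCount-late G S {k} {e} {r = m ∸ suc k} {h = ⌊ u /2⌋} regular
      (subst (k * n ≤_) (sym k+1+r≡m) (<⇒≤ kn<m)) (subst (λ m → m + (⌊ u /2⌋ + ⌊ u /2⌋) ≤ n + k * n) (sym k+1+r≡m) room) size)
    where
    kn<m = ≰⇒> m≰kn
    -- The rounds of the last block that remain after round `m`; half of this, rounded down, serves
    -- as `h`.
    u = n + k * n ∸ m

    -- Since `k ≤ kn < m`, the `m` sampled permutations include the first `k` and at least one more.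
    k+1+r≡m : k + suc (m ∸ suc k) ≡ m
    k+1+r≡m = trans (+-suc k _) (m+[n∸m]≡n (≤-trans (s≤s (m≤m*n k n)) kn<m))

    m+f<n+kn : m + f n < n + k * n
    m+f<n+kn = subst (m + f n <_) (trans (*-distribʳ-+ n k 1) (trans (+-comm (k * n) _) (cong (_+ k * n) (*-identityˡ n)))) m+f<

    2h≤u : ⌊ u /2⌋ + ⌊ u /2⌋ ≤ u
    2h≤u = ≤-trans (+-monoʳ-≤ ⌊ u /2⌋ (⌊n/2⌋≤⌈n/2⌉ u)) (≤-reflexive (⌊n/2⌋+⌈n/2⌉≡n u))

    room : m + (⌊ u /2⌋ + ⌊ u /2⌋) ≤ n + k * n
    room = ≤-trans (+-monoʳ-≤ m 2h≤u) (≤-reflexive (m+[n∸m]≡n (≤-trans (m≤m+n m (f n)) (<⇒≤ m+f<n+kn))))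

    -- Rounding down may lose 1 in `2h`, which the strict inequality `f n < u` makes up for.
    f≤2h : f n ≤ ⌊ u /2⌋ + ⌊ u /2⌋
    f≤2h = s≤s⁻¹ (begin
      suc (f n)                       ≤⟨ m+n≤o⇒m≤o∸n (suc (f n)) (subst (_≤ n + k * n) (cong suc (+-comm m (f n))) m+f<n+kn) ⟩
      u                               ≡⟨ ⌊n/2⌋+⌈n/2⌉≡n u ⟨
      ⌊ u /2⌋ + ⌊ suc u /2⌋           ≤⟨ +-monoʳ-≤ ⌊ u /2⌋ (⌊n/2⌋-mono {suc u} {suc (suc u)} (n≤1+n (suc u))) ⟩
      ⌊ u /2⌋ + suc ⌊ u /2⌋           ≡⟨ +-suc ⌊ u /2⌋ _ ⟩
      suc (⌊ u /2⌋ + ⌊ u /2⌋)         ∎)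

    size : 8 * (e + 1) * n ≤ ⌊ u /2⌋ * ⌊ u /2⌋
    size = *-cancelˡ-≤ 4 (begin
      4 * (8 * (e + 1) * n)                               ≡⟨ regroup e n ⟩
      32 * (e + 1) * n                                    ≤⟨ large n N≤n ⟩
      f n * f n                                           ≤⟨ *-mono-≤ f≤2h f≤2h ⟩
      (⌊ u /2⌋ + ⌊ u /2⌋) * (⌊ u /2⌋ + ⌊ u /2⌋)           ≡⟨ square ⌊ u /2⌋ ⟩
      4 * (⌊ u /2⌋ * ⌊ u /2⌋)                             ∎)
      where
      regroup : ∀ e n → 4 * (8 * (e + 1) * n) ≡ 32 * (e + 1) * n
      regroup = solve-∀
      square : ∀ h → (h + h) * (h + h) ≡ 4 * (h * h)
      square = solve-∀
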